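{- Let $G$ be a connected graph and let $S \subseteq V(G)$. Let $H$ be the minimum flower subgraph of $G$ whose vertex set contains $\langle S \rangle$. Then $S$ is monophonically convexly independent if and only if for every mp-subgraph $M$ of $H$ the following holds: if $M$ is a petal mp-subgraph of $H$, then $S \cap V(M)$ is contained in a stamen set for $M$ in $H$; otherwise $S \cap V(M) = \varnothing$.
   Context: All graphs are finite, simple and undirected. Monophonic convexity: a set $S \subseteq V(G)$ is monophonically convex if every vertex of every induced path joining two vertices of $S$ lies in $S$; the monophonic convex hull $\langle S \rangle$ is the smallest monophonically convex set containing $S$. $S$ is monophonically convexly independent if $v \notin \langle S - \{v\} \rangle$ for every $v \in S$. A clique separator of a connected graph is a clique whose removal disconnects the graph. A connected graph is prime if it has no clique separator. A maximal prime subgraph (mp-subgraph) of $G$ is a maximal induced subgraph of $G$ that is prime. For an mp-subgraph $M$ of $G$, $\partial M$ denotes the set of vertices of $M$ that belong to some other mp-subgraph of $G$, and $M^\circ = V(M) - \partial M$. $M$ is a petal mp-subgraph of $G$ if $M^\circ \neq \varnothing$ and $\partial M$ is a clique (possibly empty). A flower subgraph of $G$ is defined recursively: $G$ is a flower subgraph of $G$, and if $G'$ is a flower subgraph of $G$ and $M$ is a petal mp-subgraph of $G'$, then $G' - M^\circ$ is a flower subgraph of $G$. For a petal mp-subgraph $M$ of a graph $G$, a set $X \subseteq M^\circ$ is a stamen set for $M$ in $G$ if either (Type 1) $|X| = 1$; or (Type 2) $X = \{u_1,u_2\}$ and every vertex of $\partial M$ is adjacent to both $u_1$ and $u_2$;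 or (Type 3) $|X| \ge 2$ and $X \cup \partial M$ is a clique. -}

module Defs where

open import Data.Nat using (ℕ; suc; _≥_)
open import Data.Fin using (Fin; toℕ)
open import Data.Fin.Subset using (Subset; _∈_; _∉_; _⊆_; ∣_∣; _-_; ⊤)
open import Data.List using (List; length; lookup; head; last)
open import Data.List.Relation.Unary.All using (All)
open import Data.List.Relation.Unary.Linked using (Linked)
open import Data.List.Relation.Unary.Unique.Propositional using (Unique)
open import Data.Maybe using (just)
open import Data.Product using (Σ; ∃; _×_; ∃-syntax)
open import Data.Sum using (_⊎_)
open import Relation.Nullary using (¬_)
open import Relation.Binary using (Decidable)
open import Relation.Binary.PropositionalEquality using (_≡_; _≢_)

record Graph (n : ℕ) : Set₁ where
  field
    Adj    : Fin n → Fin n → Set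
    sym    : ∀ {x y} → Adj x y → Adj y x
    irrefl : ∀ {x} → ¬ Adj x x
    adj?   : Decidable Adj
open Graph public

module _ {n : ℕ} (G : Graph n) where

  Walk : Fin n → Fin n → List (Fin n) → Set
  Walk x y p = (head p ≡ just x) × (last p ≡ just y) × Linked (Adj G) p

  InducedPath : Fin n → Fin n → List (Fin n) → Set
  InducedPath x y p = Walk x y p × Unique p ×
    (∀ (i j : Fin (length p)) → Adj G (lookup p i) (lookup p j) →
       (toℕ j ≡ suc (toℕ i)) ⊎ (toℕ i ≡ suc (toℕ j)))

  MConvex : Subset n → Set
  MConvex D = ∀ x y p → x ∈ D → y ∈ D → InducedPath x y p → All (_∈ D) p

  InHull : Subset n → Fin n → Set
  InHull S v = ∀ (D : Subset n) → S ⊆ D → MConvex D → v ∈ D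

  HullSubset : Subset n → Subset n → Set
  HullSubset S W = ∀ v → InHull S v → v ∈ W

  MIndependent : Subset n → Set
  MIndependent S = ∀ v → v ∈ S → ¬ InHull (S - v) v

  Connected : Subset n → Set
  Connected U = (∃[ x ] x ∈ U) ×
    (∀ x y → x ∈ U → y ∈ U → ∃[ p ] (Walk x y p × All (_∈ U) p))

  Disconnected : Subset n → Set
  Disconnected U = ∃[ x ] ∃[ y ] (x ∈ U × y ∈ U ×
    (∀ p → Walk x y p → ¬ All (_∈ U) p))

  Clique : Subset n → Set
  Clique C = ∀ x y → x ∈ C → y ∈ C → x ≢ y → Adj G x y

  Minus : Subset n → Subset n → Subset n → Set
  Minus U C R = ∀ v → (v ∈ R → v ∈ U × v ∉ C) × (v ∈ U → v ∉ C → v ∈ R)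

  Prime : Subset n → Set
  Prime U = Connected U ×
    (∀ C R → C ⊆ U → Clique C → Minus U C R → ¬ Disconnected R)

  MP : Subset n → Subset n → Set
  MP W M = M ⊆ W × Prime M × (∀ M′ → M ⊆ M′ → M′ ⊆ W → Prime M′ → M′ ⊆ M)

  InBoundary : Subset n → Subset n → Fin n → Set
  InBoundary W M v = v ∈ M × ∃[ M′ ] (MP W M′ × M′ ≢ M × v ∈ M′)

  InInterior : Subset n → Subset n → Fin n → Set
  InInterior W M v = v ∈ M × ¬ InBoundary W M v

  Petal : Subset n → Subset n → Set
  Petal W M = MP W M × (∃[ v ] InInterior W M v) ×
    (∀ x y → InBoundary W M x → InBoundary W M y → x ≢ y → Adj G x y)

  data Flower : Subset n → Set where
    whole : Flower ⊤
    prune : ∀ {W M W′} → Flower W → Petal W M →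
            (∀ v → (v ∈ W′ → v ∈ W × ¬ InInterior W M v) ×
                   (v ∈ W → ¬ InInterior W M v → v ∈ W′)) →
            Flower W′

  Stamen : Subset n → Subset n → Subset n → Set
  Stamen W M X = (∀ v → v ∈ X → InInterior W M v) ×
    ( (∣ X ∣ ≡ 1)
    ⊎ (∃[ u₁ ] ∃[ u₂ ] (u₁ ≢ u₂ × (∀ v → v ∈ X → v ≡ u₁ ⊎ v ≡ u₂) ×
         u₁ ∈ X × u₂ ∈ X ×
         (∀ w → InBoundary W M w → Adj G w u₁ × Adj G w u₂)))
    ⊎ (∣ X ∣ ≥ 2 ×
         (∀ x y → (x ∈ X ⊎ InBoundary W M x) → (y ∈ X ⊎ InBoundary W M y) →
            x ≢ y → Adj G x y)) )

  MinFlowerContainingHull : Subset n → Subset n → Set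
  MinFlowerContainingHull S H = Flower H × HullSubset S H ×
    (∀ H′ → Flower H′ → HullSubset S H′ → H ⊆ H′)

  StamenCondition : Subset n → Subset n → Set
  StamenCondition S H = ∀ M → MP H M →
    (Petal H M → ∃[ X ] (Stamen H M X × (∀ v → v ∈ S → v ∈ M → v ∈ X))) ×
    (¬ Petal H M → ∀ v → v ∈ S → v ∉ M)

{-# OPTIONS --safe #-}
module Submission where

-- Two facts about convexity carry the argument. First, D is convex iff no two non-adjacent
-- vertices of D are joined by a walk whose interior avoids D; so if D is convex and K is a
-- component of H ∖ D, then C = N(K) is a clique. Second, such a pair either has K ∪ C prime, in
-- which case K ∪ C is a petal with K in its interior, or K contains the interior of a petal
-- (split along a minimal clique separator and descend into a side that avoids C).
-- Minimality of H makes S meet every petal interior. If s ∈ S is outside some convex D ⊇ S - s and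
-- D still meets every petal interior, the dichotomy puts s in the interior of a petal M with
-- (D ∪ ∂M) ∩ M a clique; letting s vary over S ∩ M yields the stamen sets. Conversely,
-- for v in a stamen set X ⊇ S ∩ M the set (H ∖ M°) ∪ (X - v) is convex, because (X - v) ∪ ∂M is
-- a clique; it contains S - v but not v.

open import Defs
open import Data.Nat using (ℕ)
open import Data.Fin.Subset using (Subset; ⊤)
open import Function.Bundles using (_⇔_)

open import Data.Bool using (true; false)
open import Data.Bool.Properties using () renaming (_≟_ to _≟ᵇ_)
open import Data.Empty using (⊥-elim)
open import Data.Fin using (Fin; zero; suc; toℕ)
open import Data.Fin.Properties using (any?; all?; _≟_)
open import Data.Fin.Subset
  using (_∈_; _∉_; _⊆_; _⊂_; _⊃_; ∣_∣; _─_; _-_; _∪_; _∩_; ⁅_⁆; ⊥; Nonempty)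
open import Data.Fin.Subset.Induction using (Acc; acc; ⊂-wellFounded; ⊃-wellFounded)
open import Data.Fin.Subset.Properties
open import Data.List using (List; []; _∷_; last; lookup)
open import Data.List.Membership.Propositional using () renaming (_∈_ to _∈ˡ_)
open import Data.List.Relation.Unary.All as All using (All; []; _∷_)
open import Data.List.Relation.Unary.AllPairs using ([]; _∷_)
open import Data.List.Relation.Unary.Any using (here; there; index)
open import Data.List.Relation.Unary.Any.Properties using (lookup-index)
open import Data.List.Relation.Unary.Linked using (Linked; [-]; _∷_)
open import Data.List.Relation.Unary.Unique.Propositional using (Unique)
open import Data.Maybe using (just)
open import Data.Nat using (suc; _≥_; s≤s)
open import Data.Nat.Properties using (suc-injective; ≤-trans; ≤-reflexive; <-irrefl)
open import Data.Product using (∃; ∃-syntax; _×_; _,_; proj₁; proj₂)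
open import Data.Sum using (_⊎_; inj₁; inj₂; [_,_]′)
open import Data.Vec using ([]; _∷_; tabulate)
open import Data.Vec.Properties using (≡-dec; lookup∘tabulate; lookup⇒[]=; []=⇒lookup)
open import Function using (_∘_; mk⇔)
open import Relation.Binary.PropositionalEquality as ≡ using (_≡_; _≢_; refl; subst; cong)
open import Relation.Nullary using (¬_; Dec; yes; no; does; contradiction)
open import Relation.Nullary.Decidable
  using (_×-dec_; _→-dec_; _⊎-dec_; ¬?; map′; decidable-stable; dec-true)

-- Finite subsets: comprehension, cardinality, extremal members.

private
  variable
    n : ℕ

infix 4 _≟ˢ_

_≟ˢ_ : (U V : Subset n) → Dec (U ≡ V)
_≟ˢ_ = ≡-dec _≟ᵇ_

⟪_⟫ : {P : Fin n → Set} → (∀ v → Dec (P v)) → Subset n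
⟪ P? ⟫ = tabulate (does ∘ P?)

module _ {P : Fin n → Set} (P? : ∀ v → Dec (P v)) where

  ∈⟪⟫⁺ : ∀ {v} → P v → v ∈ ⟪ P? ⟫
  ∈⟪⟫⁺ {v} Pv = lookup⇒[]= v ⟪ P? ⟫ (≡.trans (lookup∘tabulate (does ∘ P?) v) (dec-true (P? v) Pv))

  ∈⟪⟫⁻ : ∀ {v} → v ∈ ⟪ P? ⟫ → P v
  ∈⟪⟫⁻ {v} v∈ with P? v | ≡.trans (≡.sym (lookup∘tabulate (does ∘ P?) v)) ([]=⇒lookup v∈)
  ... | yes Pv | _  = Pv
  ... | no _   | ()

x∈p─q⇒x∉q : ∀ (p q : Subset n) {x} → x ∈ p ─ q → x ∉ q
x∈p─q⇒x∉q (_ ∷ p) (true  ∷ q) {zero}  ()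
x∈p─q⇒x∉q (_ ∷ p) (false ∷ q) {zero}  _  ()
x∈p─q⇒x∉q (_ ∷ p) (true  ∷ q) {suc x} x∈ = x∈p─q⇒x∉q p q (drop-there x∈) ∘ drop-there
x∈p─q⇒x∉q (_ ∷ p) (false ∷ q) {suc x} x∈ = x∈p─q⇒x∉q p q (drop-there x∈) ∘ drop-there

x∈p-y⇒x≢y : ∀ (p : Subset n) y {x} → x ∈ p - y → x ≢ y
x∈p-y⇒x≢y p y x∈ refl = x∈p─q⇒x∉q p ⁅ y ⁆ x∈ (x∈⁅x⁆ y)

∣p∣≥2 : ∀ (p : Subset n) {x y} → x ∈ p → y ∈ p → x ≢ y → ∣ p ∣ ≥ 2
∣p∣≥2 p {x} {y} x∈p y∈p x≢y =
  ≤-trans (s≤s (≤-trans (≤-reflexive (≡.sym (∣⁅x⁆∣≡1 y))) (p⊆q⇒∣p∣≤∣q∣ y⊆)))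
          (x∈p⇒∣p-x∣<∣p∣ x∈p)
  where
  y⊆ : ⁅ y ⁆ ⊆ p - x
  y⊆ z∈ with refl ← x∈⁅y⁆⇒x≡y y z∈ = x∈p∧x≢y⇒x∈p-y y∈p (x≢y ∘ ≡.sym)

module _ {P : Subset n → Set} (P? : ∀ U → Dec (P U)) where

  ∃-minimal : ∀ U → P U → ∃[ V ] P V × (∀ V′ → V′ ⊂ V → ¬ P V′)
  ∃-minimal U = go U (⊂-wellFounded U)
    where
    go : ∀ U → Acc _⊂_ U → P U → ∃[ V ] P V × (∀ V′ → V′ ⊂ V → ¬ P V′)
    go U (acc rec) PU with anySubset? (λ V → V ⊂? U ×-dec P? V)
    ... | yes (V , V⊂U , PV) = go V (rec V⊂U) PV
    ... | no none            = U , PU , λ V V⊂U PV → none (V , V⊂U , PV)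

  ∃-maximal : ∀ U → P U → ∃[ V ] U ⊆ V × P V × (∀ V′ → V ⊂ V′ → ¬ P V′)
  ∃-maximal U = go U (⊃-wellFounded U)
    where
    go : ∀ U → Acc _⊃_ U → P U → ∃[ V ] U ⊆ V × P V × (∀ V′ → V ⊂ V′ → ¬ P V′)
    go U (acc rec) PU with anySubset? (λ V → U ⊂? V ×-dec P? V)
    ... | no none            = U , ⊆-refl , PU , λ V U⊂V PV → none (V , U⊂V , PV)
    ... | yes (V , U⊂V , PV) with go V (rec U⊂V) PV
    ...   | V₁ , V⊆V₁ , rest = V₁ , ⊆-trans (proj₁ U⊂V) V⊆V₁ , rest

module _ {n : ℕ} (G : Graph n) where

  private
    variable
      a b c d x y z : Fin n
      q : List (Fin n)
      U V : Subset n

    swap-≢ : x ≢ y → y ≢ x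
    swap-≢ x≢y = x≢y ∘ ≡.sym

    adj⇒≢ : Adj G x y → x ≢ y
    adj⇒≢ xy refl = irrefl G xy

    adj-stable : ¬ ¬ Adj G x y → Adj G x y
    adj-stable {x} {y} = decidable-stable (adj? G x y)

  -- Walks and reachability

  -- Walks as an inductive family rather than as lists. Each vertex, both ends included, carries its
  -- membership in `U`, so walks are joined, reversed and cut by plain induction.
  data Reach (U : Subset n) : Fin n → Fin n → Set where
    stay : x ∈ U → Reach U x x
    step : x ∈ U → Adj G x y → Reach U y z → Reach U x z

  source∈ : Reach U x y → x ∈ U
  source∈ (stay x∈U)     = x∈U
  source∈ (step x∈U _ _) = x∈U

  target∈ : Reach U x y → y ∈ U
  target∈ (stay x∈U)   = x∈U
  target∈ (step _ _ r) = target∈ r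

  reach-mono : U ⊆ V → Reach U x y → Reach V x y
  reach-mono U⊆V (stay x∈U)      = stay (U⊆V x∈U)
  reach-mono U⊆V (step x∈U xy r) = step (U⊆V x∈U) xy (reach-mono U⊆V r)

  reach-trans : Reach U x y → Reach U y z → Reach U x z
  reach-trans (stay _)        s = s
  reach-trans (step x∈U xy r) s = step x∈U xy (reach-trans r s)

  reach-sym : Reach U x y → Reach U y x
  reach-sym (stay x∈U)      = stay x∈U
  reach-sym (step x∈U xy r) =
    reach-trans (reach-sym r) (step (source∈ r) (sym G xy) (stay x∈U))

  reach-along : Reach U x y → Adj G y z → z ∈ U → Reach U x z
  reach-along r yz z∈U = reach-trans r (step (target∈ r) yz (stay z∈U))

  reach-invariant : {P : Fin n → Set} → (∀ {v w} → v ∈ U → w ∈ U → P v → Adj G v w → P w) →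
                    Reach U x y → P x → P y
  reach-invariant pres (stay _)        Px = Px
  reach-invariant pres (step x∈U xy r) Px =
    reach-invariant pres r (pres x∈U (source∈ r) Px xy)

  reach⇒walk : Reach U x y → ∃[ p ] Walk G x y p × All (_∈ U) p
  reach⇒walk {U} {x} r with tail r
    where
    tail : ∀ {x y} → Reach U x y →
           ∃[ q ] last (x ∷ q) ≡ just y × Linked (Adj G) (x ∷ q) × All (_∈ U) (x ∷ q)
    tail (stay x∈U)          = [] , refl , [-] , x∈U ∷ []
    tail (step x∈U xy r) with tail r
    ... | q , end , lk , all = _ ∷ q , end , xy ∷ lk , x∈U ∷ all
  ... | q , end , lk , all = x ∷ q , (refl , end , lk) , all

  walk⇒reach : ∀ {p} → Walk G x y p → All (_∈ U) p → Reach U x y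
  walk⇒reach {p = []}        (() , _)
  walk⇒reach {p = _ ∷ []}    (refl , refl , _) (x∈U ∷ _)  = stay x∈U
  walk⇒reach {p = _ ∷ _ ∷ _} (refl , end , xy ∷ lk) (x∈U ∷ all) =
    step x∈U xy (walk⇒reach (refl , end , lk) all)

  -- Cut the walk after its last visit to x.
  reach-avoid : ∀ {w} x → x ≢ y → Reach U w y →
                Reach (U - x) w y ⊎ ∃[ z ] Adj G x z × Reach (U - x) z y
  reach-avoid x x≢y (stay y∈U) = inj₁ (stay (x∈p∧x≢y⇒x∈p-y y∈U (swap-≢ x≢y)))
  reach-avoid {w = w} x x≢y (step w∈U ww′ r) with reach-avoid x x≢y r
  ... | inj₂ found = inj₂ found
  ... | inj₁ r′ with w ≟ x
  ...   | yes refl = inj₂ (_ , ww′ , r′)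
  ...   | no w≢x   = inj₁ (step (x∈p∧x≢y⇒x∈p-y w∈U w≢x) ww′ r′)

  -- A walk from `x` to some `y ≢ x` can be cut so that it leaves `x` at once and never returns. The
  -- search for its second vertex therefore recurses on the smaller set `U - x`.
  reach? : ∀ U x y → Dec (Reach U x y)
  reach? U = go U (⊂-wellFounded U)
    where
    go : ∀ U → Acc _⊂_ U → ∀ x y → Dec (Reach U x y)
    go U (acc rec) x y with x ∈? U
    ... | no x∉U  = no (x∉U ∘ source∈)
    ... | yes x∈U with x ≟ y
    ...   | yes refl = yes (stay x∈U)
    ...   | no x≢y   = map′
      (λ (z , xz , r) → step x∈U xz (reach-mono (p─q⊆p U ⁅ x ⁆) r))
      (λ r → [ (λ r′ → contradiction refl (x∈p-y⇒x≢y U x (source∈ r′))) , (λ found → found) ]′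
               (reach-avoid x x≢y r))
      (any? (λ z → adj? G x z ×-dec go (U - x) (rec (x∈p⇒p-x⊂p x∈U)) z y))

  -- Induced paths and convexity

  Far : Fin n → Fin n → Set
  Far x w = x ≢ w × ¬ Adj G x w

  -- Chordless x z q: the list x ∷ q is an induced path from x to z.
  data Chordless : Fin n → Fin n → List (Fin n) → Set where
    [_]  : ∀ x → Chordless x x []
    cons : Adj G x y → Chordless y z q → All (Far x) q → Chordless x z (y ∷ q)

  chordless⇒induced : Chordless x y q → InducedPath G x y (x ∷ q)
  chordless⇒induced c = (refl , end c , linked c) , unique c , chords c
    where
    end : Chordless x y q → last (x ∷ q) ≡ just y
    end [ _ ]        = refl
    end (cons _ c _) = end c
    linked : Chordless x y q → Linked (Adj G) (x ∷ q)
    linked [ _ ]         = [-]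
    linked (cons xy c _) = xy ∷ linked c
    unique : Chordless x y q → Unique (x ∷ q)
    unique [ _ ]           = [] ∷ []
    unique (cons xy c far) = (adj⇒≢ xy ∷ All.map proj₁ far) ∷ unique c
    far-at : ∀ {x q} → All (Far x) q → ∀ i → ¬ Adj G x (lookup q i)
    far-at ((_ , ¬adj) ∷ _) zero    = ¬adj
    far-at (_ ∷ far)        (suc i) = far-at far i
    chords : Chordless x y q → ∀ i j → Adj G (lookup (x ∷ q) i) (lookup (x ∷ q) j) →
             (toℕ j ≡ suc (toℕ i)) ⊎ (toℕ i ≡ suc (toℕ j))
    chords _              zero          zero          ij = contradiction ij (irrefl G)
    chords (cons _ _ _)   zero          (suc zero)    _  = inj₁ refl
    chords (cons _ _ far) zero          (suc (suc j)) ij = contradiction ij (far-at far j)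
    chords (cons _ _ _)   (suc zero)    zero          _  = inj₂ refl
    chords (cons _ _ far) (suc (suc i)) zero          ij = contradiction (sym G ij) (far-at far i)
    chords (cons _ c _)   (suc i)       (suc j)       ij =
      [ inj₁ ∘ cong suc , inj₂ ∘ cong suc ]′ (chords c i j ij)

  induced⇒chordless : InducedPath G x y (a ∷ q) → Chordless a y q
  induced⇒chordless {q = []}        ((refl , refl , _) , _ , _) = [ _ ]
  induced⇒chordless {a = a} {q = b ∷ q} ((refl , end , ab ∷ lk) , (a≢ ∷ uniq) , chord) =
    cons ab
      (induced⇒chordless ((refl , end , lk) , uniq ,
        λ i j ij → [ inj₁ ∘ suc-injective , inj₂ ∘ suc-injective ]′ (chord (suc i) (suc j) ij)))
      -- A vertex of `q` sits at position two or later, so an edge from `a` to it would be a chord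
      -- and both alternatives are absurd.
      (All.tabulate λ w∈q → All.lookup a≢ (there w∈q) ,
        λ aw → [ (λ ()) , (λ ()) ]′
          (chord zero (suc (suc (index w∈q))) (subst (Adj G a) (lookup-index w∈q) aw)))

  -- The path is searched from its far end for the last vertex equal or adjacent to `x`; the
  -- shortcut from `x` to that vertex has no chord. If there is none, `x` is far from the whole
  -- path.
  chordless-prepend : {P : Fin n → Set} → P x → Chordless y z q → All P (y ∷ q) →
                      All (Far x) (y ∷ q) ⊎ ∃[ q′ ] Chordless x z q′ × All P (x ∷ q′)
  chordless-prepend {x = x} {y = y} Px c@([ _ ]) all with x ≟ y
  ... | yes refl = inj₂ (_ , c , all)
  ... | no x≢y with adj? G x y
  ...   | yes xy = inj₂ (_ , cons xy c [] , Px ∷ all)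
  ...   | no ¬xy = inj₁ ((x≢y , ¬xy) ∷ [])
  chordless-prepend {x = x} {y = y} Px c@(cons _ c′ _) all@(_ ∷ all′)
    with chordless-prepend Px c′ all′
  ... | inj₂ found = inj₂ found
  ... | inj₁ far with x ≟ y
  ...   | yes refl = inj₂ (_ , c , all)
  ...   | no x≢y with adj? G x y
  ...     | yes xy = inj₂ (_ , cons xy c far , Px ∷ all)
  ...     | no ¬xy = inj₁ ((x≢y , ¬xy) ∷ far)

  reach⇒chordless : Reach U x y → ∃[ q ] Chordless x y q × All (_∈ U) (x ∷ q)
  reach⇒chordless (stay x∈U)      = [] , [ _ ] , x∈U ∷ []
  reach⇒chordless (step x∈U xy r) with reach⇒chordless r
  ... | q , c , all with chordless-prepend x∈U c all
  ...   | inj₁ ((_ , ¬xy) ∷ _) = contradiction xy ¬xy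
  ...   | inj₂ found           = found

  -- Convexity in terms of arbitrary walks instead of induced paths, so that it can be applied
  -- directly to the components of `W ─ D`.
  NoEar : Subset n → Subset n → Set
  NoEar W D = ∀ {a b c d} → a ∈ D → b ∈ D → Adj G a c → Reach (W ─ D) c d → Adj G d b →
              a ≢ b → Adj G a b

  -- If `a` and `b` are not adjacent, the ear shortens to an induced path whose vertices are `a`,
  -- `b` or outside `D`. Its second vertex is neither `a` nor `b`, so it is outside `D`, against
  -- convexity.
  convex⇒noEar : ∀ {D} W → MConvex G D → NoEar W D
  convex⇒noEar {D} W convex {a} {b} a∈D b∈D ac r db a≢b = adj-stable λ ¬ab → impossible ¬ab
    (let q , ch , all = reach⇒chordless walk
     in _ , ch , All.map (∈⟪⟫⁻ E?) all , convex a b _ a∈D b∈D (chordless⇒induced ch))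
    where
    E? : ∀ v → Dec ((v ≡ a ⊎ v ≡ b) ⊎ v ∈ W ─ D)
    E? v = (v ≟ a ⊎-dec v ≟ b) ⊎-dec v ∈? (W ─ D)
    walk : Reach ⟪ E? ⟫ a b
    walk = step (∈⟪⟫⁺ E? (inj₁ (inj₁ refl))) ac
             (reach-along (reach-mono (∈⟪⟫⁺ E? ∘ inj₂) r) db (∈⟪⟫⁺ E? (inj₁ (inj₂ refl))))
    impossible : ¬ Adj G a b →
      ¬ (∃[ q ] Chordless a b q ×
        All (λ v → (v ≡ a ⊎ v ≡ b) ⊎ v ∈ W ─ D) (a ∷ q) × All (_∈ D) (a ∷ q))
    impossible ¬ab (_ , [ _ ] , _) = a≢b refl
    impossible ¬ab (_ , cons ay _ _ , _ ∷ inj₁ (inj₁ refl) ∷ _ , _) = irrefl G ay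
    impossible ¬ab (_ , cons ay _ _ , _ ∷ inj₁ (inj₂ refl) ∷ _ , _) = ¬ab ay
    impossible ¬ab (_ , cons ay _ _ , _ ∷ inj₂ y∈ ∷ _ , _ ∷ y∈D ∷ _) = x∈p─q⇒x∉q W D y∈ y∈D

  -- An induced path between vertices of `D` stays in the convex set `W`. Were it to leave `D` after
  -- `a` and return first at `v`, the excursion would be an ear making `a` and `v` adjacent, which
  -- is a chord.
  noEar⇒convex : ∀ {W D} → D ⊆ W → MConvex G W → NoEar W D → MConvex G D
  noEar⇒convex {W} {D} D⊆W convex noEar x y p x∈D y∈D path = go p path
    where
    first-return : Chordless a b q → a ∉ D → b ∈ D → All (_∈ W) (a ∷ q) →
                   ∃[ v ] ∃[ w ] v ∈ˡ q × v ∈ D × Reach (W ─ D) a w × Adj G w v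
    first-return [ _ ] a∉D b∈D _ = contradiction b∈D a∉D
    first-return (cons {y = u} au c _) a∉D b∈D (a∈W ∷ all) with u ∈? D
    ... | yes u∈D = u , _ , here refl , u∈D , stay (x∈p∧x∉q⇒x∈p─q a∈W a∉D) , au
    ... | no u∉D with first-return c u∉D b∈D all
    ...   | v , w , v∈q , v∈D , r , wv =
      v , w , there v∈q , v∈D , step (x∈p∧x∉q⇒x∈p─q a∈W a∉D) au r , wv
    scan : Chordless a b q → a ∈ D → b ∈ D → All (_∈ W) (a ∷ q) → All (_∈ D) (a ∷ q)
    scan [ _ ] a∈D _ _ = a∈D ∷ []
    scan (cons {y = u} au c far) a∈D b∈D (_ ∷ all) with u ∈? D
    ... | yes u∈D = a∈D ∷ scan c u∈D b∈D all
    ... | no u∉D with first-return c u∉D b∈D all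
    ...   | v , w , v∈q , v∈D , r , wv =
      let a≢v , ¬av = All.lookup far v∈q in contradiction (noEar a∈D v∈D au r wv a≢v) ¬av
    go : ∀ p → InducedPath G x y p → All (_∈ D) p
    go []      ((() , _) , _)
    go (_ ∷ q) path@((refl , _) , _) =
      scan (induced⇒chordless path) x∈D y∈D (convex x y _ (D⊆W x∈D) (D⊆W y∈D) path)

  -- Clique separators and mp-subgraphs

  -- A decidable form of separation by a clique. The empty clique is allowed, so an inhabited set
  -- that nothing separates is also connected.
  Separates : Subset n → Subset n → Set
  Separates U C = C ⊆ U × Clique G C ×
    ∃[ x ] ∃[ y ] x ∈ U ─ C × y ∈ U ─ C × ¬ Reach (U ─ C) x y

  clique? : ∀ C → Dec (Clique G C)
  clique? C = all? λ x → all? λ y →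
    x ∈? C →-dec y ∈? C →-dec ¬? (x ≟ y) →-dec adj? G x y

  separates? : ∀ U C → Dec (Separates U C)
  separates? U C = C ⊆? U ×-dec clique? C ×-dec any? λ x → any? λ y →
    x ∈? (U ─ C) ×-dec y ∈? (U ─ C) ×-dec ¬? (reach? (U ─ C) x y)

  unseparated⇒prime : Nonempty U → (∀ C → ¬ Separates U C) → Prime G U
  unseparated⇒prime {U} inhabited unseparated = (inhabited , connected) , noSeparator
    where
    reach : ∀ C → C ⊆ U → Clique G C → x ∈ U ─ C → y ∈ U ─ C → Reach (U ─ C) x y
    reach C C⊆U clique x∈ y∈ = decidable-stable (reach? (U ─ C) _ _)
      λ ¬r → unseparated C (C⊆U , clique , _ , _ , x∈ , y∈ , ¬r)
    connected : ∀ x y → x ∈ U → y ∈ U → ∃[ p ] (Walk G x y p × All (_∈ U) p)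
    connected x y x∈U y∈U = reach⇒walk (reach-mono (p─q⊆p U ⊥)
      (reach ⊥ (⊥-elim ∘ ∉⊥) (λ _ _ x∈⊥ → contradiction x∈⊥ ∉⊥)
        (x∈p∧x∉q⇒x∈p─q x∈U ∉⊥) (x∈p∧x∉q⇒x∈p─q y∈U ∉⊥)))
    noSeparator : ∀ C R → C ⊆ U → Clique G C → Minus G U C R → ¬ Disconnected G R
    noSeparator C R C⊆U clique minus (x , y , x∈R , y∈R , ¬walk) =
      let p , walk , all = reach⇒walk (reach C C⊆U clique (to x∈R) (to y∈R))
      in ¬walk p walk (All.map (λ {v} v∈ →
           proj₂ (minus v) (p─q⊆p U C v∈) (x∈p─q⇒x∉q U C v∈)) all)
      where
      to : ∀ {v} → v ∈ R → v ∈ U ─ C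
      to {v} v∈R = let v∈U , v∉C = proj₁ (minus v) v∈R in x∈p∧x∉q⇒x∈p─q v∈U v∉C

  prime⇒unseparated : Prime G U → ∀ C → ¬ Separates U C
  prime⇒unseparated {U} (_ , noSeparator) C (C⊆U , clique , x , y , x∈ , y∈ , ¬r) =
    noSeparator C (U ─ C) C⊆U clique
      (λ v → (λ v∈ → p─q⊆p U C v∈ , x∈p─q⇒x∉q U C v∈) , x∈p∧x∉q⇒x∈p─q)
      (x , y , x∈ , y∈ , λ p walk all → ¬r (walk⇒reach walk all))

  prime⊎separated : Nonempty U → Prime G U ⊎ ∃[ C ] Separates U C
  prime⊎separated {U} inhabited with anySubset? (separates? U)
  ... | yes separated  = inj₂ separated
  ... | no unseparated = inj₁ (unseparated⇒prime inhabited λ C sep → unseparated (C , sep))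

  prime? : ∀ U → Dec (Prime G U)
  prime? U = map′
    (λ (inhabited , unseparated) → unseparated⇒prime inhabited λ C sep → unseparated (C , sep))
    (λ prime → proj₁ (proj₁ prime) , λ (C , sep) → prime⇒unseparated prime C sep)
    (any? (_∈? U) ×-dec ¬? (anySubset? (separates? U)))

  mp? : ∀ W M → Dec (MP G W M)
  mp? W M = M ⊆? W ×-dec prime? M ×-dec map′ to from (¬? (anySubset? larger?))
    where
    Larger : Subset n → Set
    Larger M′ = (M ⊆ M′ × M′ ⊆ W × Prime G M′) × ¬ M′ ⊆ M
    larger? : ∀ M′ → Dec (Larger M′)
    larger? M′ = (M ⊆? M′ ×-dec M′ ⊆? W ×-dec prime? M′) ×-dec ¬? (M′ ⊆? M)
    to : ¬ ∃ Larger → ∀ M′ → M ⊆ M′ → M′ ⊆ W → Prime G M′ → M′ ⊆ M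
    to none M′ M⊆M′ M′⊆W prime′ = decidable-stable (M′ ⊆? M)
      λ M′⊈M → none (M′ , (M⊆M′ , M′⊆W , prime′) , M′⊈M)
    from : (∀ M′ → M ⊆ M′ → M′ ⊆ W → Prime G M′ → M′ ⊆ M) → ¬ ∃ Larger
    from maximal (M′ , (M⊆M′ , M′⊆W , prime′) , M′⊈M) = M′⊈M (maximal M′ M⊆M′ M′⊆W prime′)

  boundary? : ∀ W M v → Dec (InBoundary G W M v)
  boundary? W M v = v ∈? M ×-dec anySubset? λ M′ → mp? W M′ ×-dec ¬? (M′ ≟ˢ M) ×-dec v ∈? M′

  interior? : ∀ W M v → Dec (InInterior G W M v)
  interior? W M v = v ∈? M ×-dec ¬? (boundary? W M v)

  clique⇒prime : Nonempty U → Clique G U → Prime G U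
  clique⇒prime {U} inhabited clique = unseparated⇒prime inhabited
    λ C (_ , _ , x , y , x∈ , y∈ , ¬r) → ¬r (reach C x∈ y∈)
    where
    reach : ∀ C → x ∈ U ─ C → y ∈ U ─ C → Reach (U ─ C) x y
    reach {x} {y} C x∈ y∈ with x ≟ y
    ... | yes refl = stay x∈
    ... | no x≢y   = step x∈ (clique x y (p─q⊆p U C x∈) (p─q⊆p U C y∈) x≢y) (stay y∈)

  prime⇒⊆mp : ∀ {W} → U ⊆ W → Prime G U → ∃[ M ] MP G W M × U ⊆ M
  prime⇒⊆mp {U} {W} U⊆W prime
    with ∃-maximal (λ V → V ⊆? W ×-dec prime? V) U (U⊆W , prime)
  ... | M , U⊆M , (M⊆W , primeM) , maximal = M , (M⊆W , primeM , maximal′) , U⊆M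
    where
    maximal′ : ∀ M′ → M ⊆ M′ → M′ ⊆ W → Prime G M′ → M′ ⊆ M
    maximal′ M′ M⊆M′ M′⊆W prime′ {v} v∈M′ = decidable-stable (v ∈? M)
      λ v∉M → maximal M′ (M⊆M′ , v , v∈M′ , v∉M) (M′⊆W , prime′)

  near-pair⇒⊆mp : ∀ {W} → x ∈ W → y ∈ W → (x ≢ y → Adj G x y) → ∃[ M ] MP G W M × x ∈ M × y ∈ M
  near-pair⇒⊆mp {x} {y} {W} x∈W y∈W xy =
    let M , mp , ⊆M = prime⇒⊆mp ⊆W (clique⇒prime (x , ∈xˡ) clique) in M , mp , ⊆M ∈xˡ , ⊆M ∈yʳ
    where
    E : Subset n
    E = ⁅ x ⁆ ∪ ⁅ y ⁆
    ∈xˡ : x ∈ E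
    ∈xˡ = x∈p∪q⁺ (inj₁ (x∈⁅x⁆ x))
    ∈yʳ : y ∈ E
    ∈yʳ = x∈p∪q⁺ (inj₂ (x∈⁅x⁆ y))
    E⁻ : ∀ {v} → v ∈ E → v ≡ x ⊎ v ≡ y
    E⁻ v∈ = [ inj₁ ∘ x∈⁅y⁆⇒x≡y x , inj₂ ∘ x∈⁅y⁆⇒x≡y y ]′ (x∈p∪q⁻ ⁅ x ⁆ ⁅ y ⁆ v∈)
    ⊆W : E ⊆ W
    ⊆W v∈ with E⁻ v∈
    ... | inj₁ refl = x∈W
    ... | inj₂ refl = y∈W
    clique : Clique G E
    clique u v u∈ v∈ u≢v with E⁻ u∈ | E⁻ v∈
    ... | inj₁ refl | inj₁ refl = contradiction refl u≢v
    ... | inj₁ refl | inj₂ refl = xy u≢v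
    ... | inj₂ refl | inj₁ refl = sym G (xy (swap-≢ u≢v))
    ... | inj₂ refl | inj₂ refl = contradiction refl u≢v

  vertex⇒∈mp : ∀ {W} → x ∈ W → ∃[ M ] MP G W M × x ∈ M
  vertex⇒∈mp x∈W =
    let M , mp , x∈M , _ = near-pair⇒⊆mp x∈W x∈W (contradiction refl) in M , mp , x∈M

  interior⇒unique-mp : ∀ {W M M′} → InInterior G W M x → MP G W M′ → x ∈ M′ → M′ ≡ M
  interior⇒unique-mp {M = M} {M′} (x∈M , ¬boundary) mp′ x∈M′ = decidable-stable (M′ ≟ˢ M)
    λ M′≢M → ¬boundary (x∈M , M′ , mp′ , M′≢M , x∈M′)

  -- The edge lies in some mp-subgraph, and `M` is the only one through `x`.
  interior-neighbour : ∀ {W M} → MP G W M → InInterior G W M x → y ∈ W → Adj G x y → y ∈ M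
  interior-neighbour (M⊆W , _) x∈M° y∈W xy
    with M′ , mp′ , x∈M′ , y∈M′ ← near-pair⇒⊆mp (M⊆W (proj₁ x∈M°)) y∈W (λ _ → xy)
    with refl ← interior⇒unique-mp x∈M° mp′ x∈M′ = y∈M′

  ¬interior⇒boundary : ∀ {W M} → x ∈ M → ¬ InInterior G W M x → InBoundary G W M x
  ¬interior⇒boundary {x} {W} {M} x∈M ¬interior =
    decidable-stable (boundary? W M x) λ ¬boundary → ¬interior (x∈M , ¬boundary)

  -- An ear of `Y` begins and ends with removed vertices. These are interior to `M`, so the feet of
  -- the ear lie in `M`, where `Y` is a clique. This serves both for pruning a petal and for
  -- deleting one vertex of a stamen set.
  shrink-in-mp⇒convex : ∀ {W M Y} → MConvex G W → MP G W M → Y ⊆ W →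
                        (∀ {v} → v ∈ W → v ∉ Y → InInterior G W M v) →
                        (∀ {a b} → a ∈ Y → a ∈ M → b ∈ Y → b ∈ M → a ≢ b → Adj G a b) →
                        MConvex G Y
  shrink-in-mp⇒convex {W} {M} {Y} convex mp Y⊆W removed clique = noEar⇒convex Y⊆W convex
    λ a∈Y b∈Y ac r db a≢b →
      clique a∈Y (nbr (source∈ r) a∈Y (sym G ac)) b∈Y (nbr (target∈ r) b∈Y db) a≢b
    where
    nbr : c ∈ W ─ Y → a ∈ Y → Adj G c a → a ∈ M
    nbr c∈ a∈Y ca =
      interior-neighbour mp (removed (p─q⊆p W Y c∈) (x∈p─q⇒x∉q W Y c∈)) (Y⊆W a∈Y) ca

  prune-convex : ∀ {W M W′} → MConvex G W → Petal G W M →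
                 (∀ v → (v ∈ W′ → v ∈ W × ¬ InInterior G W M v) ×
                        (v ∈ W → ¬ InInterior G W M v → v ∈ W′)) →
                 MConvex G W′
  prune-convex {W} {M} convex (mp , _ , ∂-clique) W′-spec =
    shrink-in-mp⇒convex convex mp (λ {v} → proj₁ ∘ proj₁ (W′-spec v))
      (λ {v} v∈W v∉W′ → decidable-stable (interior? W M v) (v∉W′ ∘ proj₂ (W′-spec v) v∈W))
      λ {a} {b} a∈ a∈M b∈ b∈M → ∂-clique a b (∂ a∈ a∈M) (∂ b∈ b∈M)
    where
    ∂ : ∀ {v} → v ∈ _ → v ∈ M → InBoundary G W M v
    ∂ {v} v∈W′ v∈M = ¬interior⇒boundary v∈M (proj₂ (proj₁ (W′-spec v) v∈W′))

  flower-convex : ∀ {W} → Flower G W → MConvex G W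
  flower-convex whole                 _ _ _ _ _ _ = All.tabulate λ _ → ∈⊤
  flower-convex (prune flower petal W′-spec) = prune-convex (flower-convex flower) petal W′-spec

  -- Lobes: connected sets whose neighbourhood is a clique

  neighbour? : ∀ U K v → Dec (v ∈ U × v ∉ K × ∃[ k ] k ∈ K × Adj G v k)
  neighbour? U K v = v ∈? U ×-dec ¬? (v ∈? K) ×-dec any? λ k → k ∈? K ×-dec adj? G v k

  opaque

    neighbours : Subset n → Subset n → Subset n
    neighbours U K = ⟪ neighbour? U K ⟫

    neighbours⁺ : ∀ {K} → x ∈ U → x ∉ K → y ∈ K → Adj G x y → x ∈ neighbours U K
    neighbours⁺ {U = U} {K = K} x∈U x∉K y∈K xy = ∈⟪⟫⁺ (neighbour? U K) (x∈U , x∉K , _ , y∈K , xy)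

    neighbours⁻ : ∀ {K} → x ∈ neighbours U K → x ∈ U × x ∉ K × ∃[ k ] k ∈ K × Adj G x k
    neighbours⁻ {U = U} {K} = ∈⟪⟫⁻ (neighbour? U K)

    component : Subset n → Fin n → Subset n
    component U x = ⟪ reach? U x ⟫

    component⁺ : Reach U x y → y ∈ component U x
    component⁺ {U = U} {x} = ∈⟪⟫⁺ (reach? U x)

    component⁻ : y ∈ component U x → Reach U x y
    component⁻ {U = U} {x} = ∈⟪⟫⁻ (reach? U x)

  -- `disjoint`, `attached` and `closed` make `C` the neighbourhood of `K` in `U`. With `C` as a
  -- parameter, a lobe of a subset can be reread as a lobe of the larger set.
  record Lobe (U K C : Subset n) : Set where
    field
      K⊆U       : K ⊆ U
      C⊆U       : C ⊆ U
      inhabited : Nonempty K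
      connected : x ∈ K → y ∈ K → Reach K x y
      disjoint  : x ∈ C → x ∉ K
      attached  : x ∈ C → ∃[ k ] k ∈ K × Adj G x k
      closed    : x ∈ K → y ∈ U → Adj G x y → y ∈ K ⊎ y ∈ C
      clique    : Clique G C

  component-connected : ∀ {A} → Reach A x y → Reach (component A x) x y
  component-connected {A = A} r = go (stay (source∈ r)) r
    where
    go : Reach A x y → Reach A y z → Reach (component A x) y z
    go s (stay _)      = stay (component⁺ s)
    go s (step _ yw r) =
      step (component⁺ s) yw (go (reach-along s yw (source∈ r)) r)

  component-lobe : ∀ {A} → A ⊆ U → x ∈ A → Clique G (neighbours U (component A x)) →
                   Lobe U (component A x) (neighbours U (component A x))
  component-lobe {U} {x} {A} A⊆U x∈A clique = record
    { K⊆U       = A⊆U ∘ target∈ ∘ component⁻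
    ; C⊆U       = proj₁ ∘ neighbours⁻
    ; inhabited = x , component⁺ (stay x∈A)
    ; connected = λ y∈ z∈ →
        reach-trans (reach-sym (component-connected (component⁻ y∈)))
                    (component-connected (component⁻ z∈))
    ; disjoint  = proj₁ ∘ proj₂ ∘ neighbours⁻
    ; attached  = proj₂ ∘ proj₂ ∘ neighbours⁻
    ; closed    = closed
    ; clique    = clique
    }
    where
    K = component A x
    closed : y ∈ K → z ∈ U → Adj G y z → z ∈ K ⊎ z ∈ neighbours U K
    closed {y} {z} y∈K z∈U yz with z ∈? K
    ... | yes z∈K = inj₁ z∈K
    ... | no z∉K  = inj₂ (neighbours⁺ z∈U z∉K y∈K (sym G yz))

  neighbours-component-∉ : ∀ {A} → x ∈ neighbours U (component A y) → x ∉ A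
  neighbours-component-∉ {U = U} {y} {A} x∈ x∈A
    with _ , x∉K , k , k∈K , xk ← neighbours⁻ x∈
    = x∉K (component⁺ (reach-along (component⁻ k∈K) (sym G xk) x∈A))

  module _ {U K C : Subset n} (lobe : Lobe U K C) where
    open Lobe lobe

    private
      M : Subset n
      M = K ∪ C

      M⁻ : x ∈ M → x ∈ K ⊎ x ∈ C
      M⁻ = x∈p∪q⁻ K C

    lobe-⊆ : M ⊆ U
    lobe-⊆ = [ K⊆U , C⊆U ]′ ∘ M⁻

    lobe-stays : x ∈ K → Reach (U ─ C) x y → y ∈ K
    lobe-stays x∈K r = reach-invariant
      (λ _ w∈ v∈K vw → [ (λ w∈K → w∈K) , (λ w∈C → contradiction w∈C (x∈p─q⇒x∉q U C w∈)) ]′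
        (closed v∈K (p─q⊆p U C w∈) vw)) r x∈K

    -- A vertex `y` of `V` outside `M` would be cut off from `x` by the clique `V ∩ C`.
    prime∩lobe⇒⊆ : Prime G V → V ⊆ U → x ∈ V → x ∈ K → V ⊆ M
    prime∩lobe⇒⊆ {V} {x} prime V⊆U x∈V x∈K {y} y∈V = decidable-stable (y ∈? M) λ y∉M →
      prime⇒unseparated prime (V ∩ C)
        ( p∩q⊆p V C
        , (λ u v u∈ v∈ → clique u v (p∩q⊆q V C u∈) (p∩q⊆q V C v∈))
        , x , y
        , x∈p∧x∉q⇒x∈p─q x∈V (λ x∈ → disjoint (p∩q⊆q V C x∈) x∈K)
        , x∈p∧x∉q⇒x∈p─q y∈V (y∉M ∘ x∈p∪q⁺ ∘ inj₂ ∘ p∩q⊆q V C)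
        , λ r → y∉M (x∈p∪q⁺ (inj₁ (lobe-stays x∈K (reach-mono ⊆─ r)))))
      where
      ⊆─ : V ─ (V ∩ C) ⊆ U ─ C
      ⊆─ v∈ = let v∈V = p─q⊆p V (V ∩ C) v∈ in
        x∈p∧x∉q⇒x∈p─q (V⊆U v∈V) λ v∈C → x∈p─q⇒x∉q V (V ∩ C) v∈ (x∈p∩q⁺ (v∈V , v∈C))

    module _ (prime : Prime G M) where

      lobe-mp : MP G U M
      lobe-mp = lobe-⊆ , prime , λ M′ M⊆M′ M′⊆U prime′ →
        let k , k∈K = inhabited
        in prime∩lobe⇒⊆ prime′ M′⊆U (M⊆M′ (x∈p∪q⁺ (inj₁ k∈K))) k∈K

      -- An mp-subgraph through a vertex of `K` lies inside `M`, so by its own maximality it equals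
      -- `M`.
      lobe-interior : x ∈ K → InInterior G U M x
      lobe-interior x∈K = x∈p∪q⁺ (inj₁ x∈K) ,
        λ (_ , M′ , (M′⊆U , prime′ , maximal′) , M′≢M , x∈M′) →
          let M′⊆M = prime∩lobe⇒⊆ prime′ M′⊆U x∈M′ x∈K
          in M′≢M (⊆-antisym M′⊆M (maximal′ M M′⊆M lobe-⊆ prime))

      lobe-boundary : InBoundary G U M x → x ∈ C
      lobe-boundary boundary@(x∈M , _) with M⁻ x∈M
      ... | inj₁ x∈K = contradiction boundary (proj₂ (lobe-interior x∈K))
      ... | inj₂ x∈C = x∈C

      lobe-petal : Petal G U M
      lobe-petal =
        let k , k∈K = inhabited
        in lobe-mp , (k , lobe-interior k∈K) ,
           λ x y ∂x ∂y → clique x y (lobe-boundary ∂x) (lobe-boundary ∂y)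

  -- This makes C the exact boundary of K ∪ C when K ∪ C is prime.
  Full : Subset n → Subset n → Subset n → Set
  Full H K C = ∀ {x} → x ∈ C → ∃[ z ] z ∈ H × z ∉ K × z ∉ C × Adj G x z

  -- Splitting a lobe along a minimal clique separator.

  module _ {H K C : Subset n} (lobe : Lobe H K C) where
    open Lobe lobe

    private
      B : Subset n
      B = K ∪ C

    module _ {Q : Subset n} (Q⊆U : Q ⊆ B) (Q-clique : Clique G Q)
             (minimal : ∀ Q′ → Q′ ⊂ Q → ¬ Separates B Q′) where

      private
        L N : Fin n → Subset n
        L x = component (B ─ Q) x
        N x = neighbours B (L x)

        N⊆Q : N x ⊆ Q
        N⊆Q {x} {v} v∈N = decidable-stable (v ∈? Q) λ v∉Q →
          neighbours-component-∉ {U = B} v∈N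
            (x∈p∧x∉q⇒x∈p─q (proj₁ (neighbours⁻ v∈N)) v∉Q)

        N-clique : Clique G (N x)
        N-clique u v u∈ v∈ = Q-clique u v (N⊆Q u∈) (N⊆Q v∈)

        side : x ∈ B ─ Q → Lobe B (L x) (N x)
        side x∈ = component-lobe (p─q⊆p B Q) x∈ N-clique

        widen : B ─ Q ⊆ B ─ N x
        widen v∈ = x∈p∧x∉q⇒x∈p─q (p─q⊆p B Q v∈) (x∈p─q⇒x∉q B Q v∈ ∘ N⊆Q)

        -- By minimality of Q, both sides of the separation see all of Q.
        Q⊆N : x ∈ B ─ Q → y ∈ B ─ Q → ¬ Reach (B ─ Q) x y → Q ⊆ N x
        Q⊆N {x} {y} x∈ y∈ ¬r {q} q∈Q = decidable-stable (q ∈? N x) λ q∉N →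
          minimal (N x) (N⊆Q , q , q∈Q , q∉N)
            ( Lobe.C⊆U (side x∈) , N-clique , x , y , widen x∈ , widen y∈
            , λ r → ¬r (component⁻ (lobe-stays (side x∈) (component⁺ (stay x∈)) r)))

      -- A side that avoids `C` lies in `K`, and edges from `K` into `H` end in `B`, so the side is
      -- a lobe of `H` too. It is full because every vertex of `Q` also has a neighbour on the side
      -- of `y`.
      separated-side : x ∈ B ─ Q → y ∈ B ─ Q → ¬ Reach (B ─ Q) x y →
                       (∀ {v} → v ∈ L x → v ∉ C) →
                       ∃[ L′ ] ∃[ N′ ] Lobe H L′ N′ × Full H L′ N′ × L′ ⊂ K
      separated-side {x} {y} x∈ y∈ ¬r avoids =
        L x , N x , lobe′ , full , L⊆K , witness
        where
        open Lobe (side x∈) using () renaming (K⊆U to L⊆U)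
        L⊆K : L x ⊆ K
        L⊆K v∈ = [ (λ v∈K → v∈K) , (λ v∈C → contradiction v∈C (avoids v∈)) ]′
          (x∈p∪q⁻ K C (L⊆U v∈))
        lobe′ : Lobe H (L x) (N x)
        lobe′ = record
          { K⊆U       = K⊆U ∘ L⊆K
          ; C⊆U       = lobe-⊆ lobe ∘ Lobe.C⊆U (side x∈)
          ; inhabited = Lobe.inhabited (side x∈)
          ; connected = Lobe.connected (side x∈)
          ; disjoint  = Lobe.disjoint (side x∈)
          ; attached  = Lobe.attached (side x∈)
          ; closed    = λ v∈ w∈ vw →
              Lobe.closed (side x∈) v∈ (x∈p∪q⁺ (closed (L⊆K v∈) w∈ vw)) vw
          ; clique    = N-clique
          }
        full : Full H (L x) (N x)
        full v∈N =
          let z , z∈Ly , vz = Lobe.attached (side y∈) (Q⊆N y∈ x∈ (¬r ∘ reach-sym) (N⊆Q v∈N))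
              yz = component⁻ z∈Ly
          in z , lobe-⊆ lobe (p─q⊆p B Q (target∈ yz))
               , (λ z∈Lx → ¬r (reach-trans (component⁻ z∈Lx) (reach-sym yz)))
               , x∈p─q⇒x∉q B Q (target∈ yz) ∘ N⊆Q
               , vz
        y∉L : y ∉ L x
        y∉L = ¬r ∘ component⁻
        witness : ∃[ k ] k ∈ K × k ∉ L x
        witness with x∈p∪q⁻ K C (p─q⊆p B Q y∈)
        ... | inj₁ y∈K = y , y∈K , y∉L
        -- A neighbour `k` of `y` in `K` is missing from `L x`: otherwise `y` would lie in `N x`,
        -- hence in `Q`.
        ... | inj₂ y∈C with attached y∈C
        ...   | k , k∈K , yk = k , k∈K , λ k∈L → x∈p─q⇒x∉q B Q y∈
          (N⊆Q (neighbours⁺ (p─q⊆p B Q y∈) y∉L k∈L yk))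

      -- The clique C meets at most one side.
      smaller-side : x ∈ B ─ Q → y ∈ B ─ Q → ¬ Reach (B ─ Q) x y →
                     ∃[ L′ ] ∃[ N′ ] Lobe H L′ N′ × Full H L′ N′ × L′ ⊂ K
      smaller-side {x} {y} x∈ y∈ ¬r with any? (λ v → v ∈? L x ×-dec v ∈? C)
      ... | no none = separated-side x∈ y∈ ¬r λ v∈L v∈C → none (_ , v∈L , v∈C)
      ... | yes (v , v∈L , v∈C) = separated-side y∈ x∈ (¬r ∘ reach-sym) avoids
        where
        avoids : ∀ {w} → w ∈ L y → w ∉ C
        avoids {w} w∈L w∈C with v ≟ w
        ... | yes refl = ¬r (reach-trans (component⁻ v∈L) (reach-sym (component⁻ w∈L)))
        ... | no v≢w   = ¬r (reach-trans
          (reach-along (component⁻ v∈L) (clique v w v∈C w∈C v≢w) (target∈ (component⁻ w∈L)))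
          (reach-sym (component⁻ w∈L)))

    -- Splitting creates fullness: the opposite side of the separator gives each vertex of `N` a
    -- neighbour outside `L` and `N`. This starts the descent to a petal.
    split-lobe : Separates B V → ∃[ L ] ∃[ N ] Lobe H L N × Full H L N × L ⊂ K
    split-lobe sep with ∃-minimal (separates? B) _ sep
    ... | Q , (Q⊆U , Q-clique , x , y , x∈ , y∈ , ¬r) , minimal =
      smaller-side Q⊆U Q-clique minimal x∈ y∈ ¬r

    lobe-inhabited : Nonempty B
    lobe-inhabited = let k , k∈K = inhabited in k , x∈p∪q⁺ (inj₁ k∈K)

  -- Split until `K ∪ C` is prime; `K` shrinks strictly each time. In the prime case a vertex of `C`
  -- has a neighbour outside `K ∪ C` by fullness, so it is not interior and the interior stays
  -- within `K`.
  full-lobe⇒petal : ∀ {H K C} → Lobe H K C → Full H K C →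
                    ∃[ M ] Petal G H M × (∀ {v} → InInterior G H M v → v ∈ K)
  full-lobe⇒petal {H} {K} {C} = go (⊂-wellFounded K)
    where
    go : ∀ {K C} → Acc _⊂_ K → Lobe H K C → Full H K C →
         ∃[ M ] Petal G H M × (∀ {v} → InInterior G H M v → v ∈ K)
    go {K} {C} (acc rec) lobe full with prime⊎separated (lobe-inhabited lobe)
    ... | inj₂ (_ , sep) =
      let L , N , lobe′ , full′ , L⊂K = split-lobe lobe sep
          M , petal , M°⊆L = go (rec L⊂K) lobe′ full′
      in M , petal , proj₁ L⊂K ∘ M°⊆L
    ... | inj₁ prime = K ∪ C , lobe-petal lobe prime , M°⊆K
      where
      M°⊆K : ∀ {v} → InInterior G H (K ∪ C) v → v ∈ K
      M°⊆K v∈M°@(v∈M , _) with x∈p∪q⁻ K C v∈M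
      ... | inj₁ v∈K = v∈K
      ... | inj₂ v∈C with full v∈C
      ...   | z , z∈H , z∉K , z∉C , vz = contradiction
        (x∈p∪q⁻ K C (interior-neighbour (lobe-mp lobe prime) v∈M° z∈H vz)) [ z∉K , z∉C ]′

  -- Convex sets that meet every petal interior.

  Hits : Subset n → Subset n → Set
  Hits H D = ∀ M → Petal G H M → ∃[ t ] t ∈ D × InInterior G H M t

  -- Take `K` to be the component of `s` in `H ─ D`. Its neighbourhood `C` lies in `D` and is a
  -- clique, since paths through `K` are ears of `D`. The same `C` contains both `D ∩ M` and the
  -- boundary of `M`.
  missed⇒petal : ∀ {H D s} → MConvex G D → Hits H D → s ∈ H → s ∉ D →
                 ∃[ M ] ∃[ C ] Petal G H M × InInterior G H M s × Clique G C ×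
                   (∀ {v} → v ∈ M → v ∈ D ⊎ InBoundary G H M v → v ∈ C)
  missed⇒petal {H} {D} {s} convex hits s∈H s∉D = result
    where
    A K C : Subset n
    A = H ─ D
    K = component A s
    C = neighbours H K
    s∈A : s ∈ A
    s∈A = x∈p∧x∉q⇒x∈p─q s∈H s∉D
    K⁻ : ∀ {v} → v ∈ K → Reach A s v
    K⁻ = component⁻
    C⊆D : C ⊆ D
    C⊆D {v} v∈C = decidable-stable (v ∈? D) λ v∉D → neighbours-component-∉ {U = H} v∈C
      (x∈p∧x∉q⇒x∈p─q (proj₁ (neighbours⁻ v∈C)) v∉D)
    K∩D : ∀ {v} → v ∈ K → v ∉ D
    K∩D = x∈p─q⇒x∉q H D ∘ target∈ ∘ K⁻
    clique : Clique G C
    clique u v u∈ v∈ u≢v =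
      let _ , _ , k , k∈K , uk = neighbours⁻ u∈
          _ , _ , l , l∈K , vl = neighbours⁻ v∈
      in convex⇒noEar H convex (C⊆D u∈) (C⊆D v∈) uk
           (reach-trans (reach-sym (K⁻ k∈K)) (K⁻ l∈K)) (sym G vl) u≢v
    lobe : Lobe H K C
    lobe = component-lobe (p─q⊆p H D) s∈A clique
    result : ∃[ M ] ∃[ C ] Petal G H M × InInterior G H M s × Clique G C ×
               (∀ {v} → v ∈ M → v ∈ D ⊎ InBoundary G H M v → v ∈ C)
    result with prime⊎separated (lobe-inhabited lobe)
    -- If `K ∪ C` were separated, some petal interior would lie inside `K` and so be missed by `D`.
    ... | inj₂ (_ , sep) =
      let L , N , lobe′ , full , L⊂K = split-lobe lobe sep
          M , petal , M°⊆L = full-lobe⇒petal lobe′ full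
          t , t∈D , t∈M° = hits M petal
      in contradiction t∈D (K∩D (proj₁ L⊂K (M°⊆L t∈M°)))
    ... | inj₁ prime = K ∪ C , C , lobe-petal lobe prime
      , lobe-interior lobe prime (component⁺ (stay s∈A)) , clique , λ where
        v∈M (inj₁ v∈D) → [ (λ v∈K → contradiction v∈D (K∩D v∈K)) , (λ v∈C → v∈C) ]′
                           (x∈p∪q⁻ K C v∈M)
        _   (inj₂ ∂v)  → lobe-boundary lobe prime ∂v

  -- The two implications of the equivalence.

  module _ {S H : Subset n} (min : MinFlowerContainingHull G S H) where

    private
      flower : Flower G H
      flower = proj₁ min

      S⊆H : S ⊆ H
      S⊆H {v} v∈S = proj₁ (proj₂ min) v λ D S⊆D _ → S⊆D v∈S

    -- If `S` missed the interior of `M`, pruning `M` would leave a flower that contains `S` and,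
    -- being convex, its hull. Minimality would put `H` inside it, although `m` was removed.
    minFlower-hits : Hits H S
    minFlower-hits M petal@(mp , (m , m∈M°) , _)
      with any? (λ v → v ∈? S ×-dec interior? H M v)
    ... | yes found = found
    ... | no none   = contradiction m∈M° (proj₂ (∈⟪⟫⁻ H′? (H⊆H′ (proj₁ mp (proj₁ m∈M°)))))
      where
      H′? : ∀ v → Dec (v ∈ H × ¬ InInterior G H M v)
      H′? v = v ∈? H ×-dec ¬? (interior? H M v)
      H′-spec : ∀ v → (v ∈ ⟪ H′? ⟫ → v ∈ H × ¬ InInterior G H M v) ×
                      (v ∈ H → ¬ InInterior G H M v → v ∈ ⟪ H′? ⟫)
      H′-spec v = ∈⟪⟫⁻ H′? , λ v∈H v∉M° → ∈⟪⟫⁺ H′? (v∈H , v∉M°)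
      H⊆H′ : H ⊆ ⟪ H′? ⟫
      H⊆H′ = proj₂ (proj₂ min) ⟪ H′? ⟫ (prune flower petal H′-spec) λ v inHull →
        inHull ⟪ H′? ⟫ (λ s∈S → ∈⟪⟫⁺ H′? (S⊆H s∈S , λ s∈M° → none (_ , s∈S , s∈M°)))
          (prune-convex (flower-convex flower) petal H′-spec)

    module _ (independent : MIndependent G S) where

      -- Independence only denies that every convex `D` around `S - s` contains `s`, so the petal is
      -- obtained under double negation. The conclusions drawn from it are decidable or negative.
      independent⇒missed : ∀ {s} → s ∈ S → Hits H (S - s) →
        ¬ ¬ (∃[ M ] ∃[ C ] Petal G H M × InInterior G H M s × Clique G C ×
              (∀ {v} → v ∈ M → v ∈ S - s ⊎ InBoundary G H M v → v ∈ C))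
      independent⇒missed {s} s∈S hits none = independent s s∈S λ D S-s⊆D convex →
        decidable-stable (s ∈? D) λ s∉D →
          let hitsD = λ M petal → let t , t∈ , t∈M° = hits M petal in t , S-s⊆D t∈ , t∈M°
              M , C , petal , s∈M° , clique , ⊆C = missed⇒petal convex hitsD (S⊆H s∈S) s∉D
          in none (M , C , petal , s∈M° , clique ,
                   λ v∈M → ⊆C v∈M ∘ [ inj₁ ∘ S-s⊆D , inj₂ ]′)

      -- If `s` were in no petal interior, every vertex of `S` hitting a petal would differ from
      -- `s`, and `S - s` would still hit them all.
      ∈petal-interior : ∀ {s} → s ∈ S → ¬ ¬ (∃[ M ] Petal G H M × InInterior G H M s)
      ∈petal-interior {s} s∈S none = independent⇒missed s∈S hits
        λ (M , _ , petal , s∈M° , _) → none (M , petal , s∈M°)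
        where
        hits : Hits H (S - s)
        hits M petal with minFlower-hits M petal
        ... | t , t∈S , t∈M° =
          t , x∈p∧x≢y⇒x∈p-y t∈S (λ where refl → none (M , petal , t∈M°)) , t∈M°

      -- The second vertex `t` keeps `M` hit after `s` is deleted. The petal then found around `s`
      -- must be `M`, and its clique contains `x` and `y`.
      petal-adjacent : ∀ {M s t} → s ∈ S → InInterior G H M s →
                       t ∈ S → InInterior G H M t → t ≢ s →
                       x ∈ M → y ∈ M → x ∈ S - s ⊎ InBoundary G H M x →
                       y ∈ S - s ⊎ InBoundary G H M y → x ≢ y → Adj G x y
      petal-adjacent {x} {y} {M} {s} {t} s∈S s∈M° t∈S t∈M° t≢s x∈M y∈M x∈ y∈ x≢y =
        adj-stable λ ¬xy → independent⇒missed s∈S hits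
          λ (M′ , C , (mp′ , _) , s∈M′° , clique , ⊆C) →
            conclude ¬xy (interior⇒unique-mp s∈M° mp′ (proj₁ s∈M′°)) clique ⊆C
        where
        conclude : ∀ {M′ C} → ¬ Adj G x y → M′ ≡ M → Clique G C →
                   ¬ (∀ {v} → v ∈ M′ → v ∈ S - s ⊎ InBoundary G H M′ v → v ∈ C)
        conclude ¬xy refl clique ⊆C = ¬xy (clique x y (⊆C x∈M x∈) (⊆C y∈M y∈) x≢y)
        hits : Hits H (S - s)
        hits M′ petal′ with minFlower-hits M′ petal′
        ... | u , u∈S , u∈M′° with u ≟ s
        ...   | no u≢s   = u , x∈p∧x≢y⇒x∈p-y u∈S u≢s , u∈M′°
        -- A petal hit by `s` is `M` itself, so `t` can replace `s`.
        ...   | yes refl with refl ← interior⇒unique-mp s∈M° (proj₁ petal′) (proj₁ u∈M′°) =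
          t , x∈p∧x≢y⇒x∈p-y t∈S t≢s , t∈M°

      independent⇒interior : ∀ {M} → MP G H M → x ∈ S → x ∈ M → InInterior G H M x
      independent⇒interior {x} {M} mp x∈S x∈M = decidable-stable (interior? H M x) λ ¬interior →
        ∈petal-interior x∈S λ (M′ , petal′ , x∈M′°) →
          ¬interior (subst (λ M → InInterior G H M x) (≡.sym (interior⇒unique-mp x∈M′° mp x∈M)) x∈M′°)

      independent⇒petal : ∀ {M} → MP G H M → x ∈ S → x ∈ M → ¬ ¬ Petal G H M
      independent⇒petal mp x∈S x∈M ¬petal = ∈petal-interior x∈S λ (M′ , petal′ , x∈M′°) →
        ¬petal (subst (Petal G H) (≡.sym (interior⇒unique-mp x∈M′° mp x∈M)) petal′)

      -- One, two or at least three vertices in `S ∩ M` give Types 1, 2 and 3. Adjacency of two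
      -- vertices of `S ∩ M` is obtained by deleting a third one; with only two, each is just seen
      -- to be adjacent to the whole boundary.
      petal-stamen : ∀ M → Petal G H M → ∃[ X ] (Stamen G H M X × (∀ v → v ∈ S → v ∈ M → v ∈ X))
      petal-stamen M petal@(mp , _ , ∂-clique) with minFlower-hits M petal
      ... | s , s∈S , s∈M°@(s∈M , _) = bySecond (any? (other? s))
        where
        other? : ∀ w v → Dec ((v ∈ S × v ∈ M) × v ≢ w)
        other? w v = (v ∈? S ×-dec v ∈? M) ×-dec ¬? (v ≟ w)
        T : Subset n
        T = S ∩ M
        T⁻ : x ∈ T → x ∈ S × x ∈ M
        T⁻ = x∈p∩q⁻ S M
        T⇒interior : ∀ v → v ∈ T → InInterior G H M v
        T⇒interior v v∈T = let v∈S , v∈M = T⁻ v∈T in independent⇒interior mp v∈S v∈M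
        S∩M⊆T : ∀ v → v ∈ S → v ∈ M → v ∈ T
        S∩M⊆T v v∈S v∈M = x∈p∩q⁺ (v∈S , v∈M)
        adjacent : ∀ {z t} → z ∈ T → t ∈ T → t ≢ z → x ∈ M → y ∈ M →
                   x ∈ S - z ⊎ InBoundary G H M x → y ∈ S - z ⊎ InBoundary G H M y →
                   x ≢ y → Adj G x y
        adjacent z∈T t∈T = petal-adjacent (proj₁ (T⁻ z∈T)) (T⇒interior _ z∈T)
                                          (proj₁ (T⁻ t∈T)) (T⇒interior _ t∈T)
        -- Since t is not in the hull of S - t, the set (T - t) ∪ ∂M is a clique.
        T~∂ : ∀ {t} → x ∈ T → t ∈ T → t ≢ x → InBoundary G H M y → Adj G y x
        T~∂ {y = y} x∈T t∈T t≢x ∂y = adjacent t∈T x∈T (swap-≢ t≢x) (proj₁ ∂y) (proj₂ (T⁻ x∈T))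
          (inj₂ ∂y) (inj₁ (x∈p∧x≢y⇒x∈p-y (proj₁ (T⁻ x∈T)) (swap-≢ t≢x)))
          λ where refl → proj₂ (T⇒interior y x∈T) ∂y
        Result : Set
        Result = ∃[ X ] (Stamen G H M X × (∀ v → v ∈ S → v ∈ M → v ∈ X))
        s∈T : s ∈ T
        s∈T = S∩M⊆T s s∈S s∈M
        byThird : ∀ {u} → u ∈ T → u ≢ s →
                  Dec (∃[ w ] ((w ∈ S × w ∈ M) × w ≢ s) × w ≢ u) → Result
        byThird {u} u∈T u≢s (no none) = T , (T⇒interior , inj₂ (inj₁
          ( s , u , swap-≢ u≢s , only , s∈T , u∈T
          , λ w ∂w → T~∂ s∈T u∈T u≢s ∂w , T~∂ u∈T s∈T (swap-≢ u≢s) ∂w))) , S∩M⊆T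
          where
          only : ∀ v → v ∈ T → v ≡ s ⊎ v ≡ u
          only v v∈T with v ≟ s | v ≟ u
          ... | yes v≡s | _       = inj₁ v≡s
          ... | no _    | yes v≡u = inj₂ v≡u
          ... | no v≢s  | no v≢u  = contradiction (v , (T⁻ v∈T , v≢s) , v≢u) none
        byThird {u} u∈T u≢s (yes (w , (w∈S∩M , w≢s) , w≢u)) =
          T , (T⇒interior , inj₂ (inj₂ (∣p∣≥2 T s∈T u∈T (swap-≢ u≢s) , clique))) , S∩M⊆T
          where
          w∈T : w ∈ T
          w∈T = x∈p∩q⁺ w∈S∩M
          -- Among the three distinct vertices `s`, `u`, `w`, one differs from both `x` and `y`.
          third : ∀ x y → ∃[ t ] t ∈ T × t ≢ x × t ≢ y
          third x y with s ≟ x | s ≟ y | u ≟ x | u ≟ y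
          ... | no s≢x   | no s≢y   | _        | _        = s , s∈T , s≢x , s≢y
          ... | yes refl | _        | _        | no u≢y   = u , u∈T , u≢s , u≢y
          ... | yes refl | _        | _        | yes refl = w , w∈T , w≢s , w≢u
          ... | no _     | yes refl | no u≢x   | _        = u , u∈T , u≢x , u≢s
          ... | no _     | yes refl | yes refl | _        = w , w∈T , w≢u , w≢s
          pick : ∀ x → ∃[ t ] t ∈ T × t ≢ x
          pick x = let t , t∈T , t≢x , _ = third x x in t , t∈T , t≢x
          clique : ∀ x y → (x ∈ T ⊎ InBoundary G H M x) → (y ∈ T ⊎ InBoundary G H M y) →
                   x ≢ y → Adj G x y
          clique x y (inj₁ x∈T) (inj₁ y∈T) x≢y =
            let t , t∈T , t≢x , t≢y = third x y
                x∈S , x∈M = T⁻ x∈T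
                y∈S , y∈M = T⁻ y∈T
            in adjacent t∈T x∈T (swap-≢ t≢x) x∈M y∈M
                 (inj₁ (x∈p∧x≢y⇒x∈p-y x∈S (swap-≢ t≢x)))
                 (inj₁ (x∈p∧x≢y⇒x∈p-y y∈S (swap-≢ t≢y))) x≢y
          clique x y (inj₁ x∈T) (inj₂ ∂y)  _ =
            let t , t∈T , t≢x = pick x in sym G (T~∂ x∈T t∈T t≢x ∂y)
          clique x y (inj₂ ∂x)  (inj₁ y∈T) _ =
            let t , t∈T , t≢y = pick y in T~∂ y∈T t∈T t≢y ∂x
          clique x y (inj₂ ∂x)  (inj₂ ∂y)  x≢y = ∂-clique x y ∂x ∂y x≢y
        bySecond : Dec (∃[ u ] (u ∈ S × u ∈ M) × u ≢ s) → Result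
        bySecond (yes (u , u∈S∩M , u≢s)) = byThird (x∈p∩q⁺ u∈S∩M) u≢s
          (any? λ w → other? s w ×-dec ¬? (w ≟ u))
        bySecond (no none) = ⁅ s ⁆ , (interior , inj₁ (∣⁅x⁆∣≡1 s)) , contains
          where
          interior : ∀ v → v ∈ ⁅ s ⁆ → InInterior G H M v
          interior v v∈ with refl ← x∈⁅y⁆⇒x≡y s v∈ = s∈M°
          contains : ∀ v → v ∈ S → v ∈ M → v ∈ ⁅ s ⁆
          contains v v∈S v∈M with v ≟ s
          ... | yes refl = x∈⁅x⁆ s
          ... | no v≢s   = contradiction (v , (v∈S , v∈M) , v≢s) none

      independent⇒stamenCondition : StamenCondition G S H
      independent⇒stamenCondition M mp =
        petal-stamen M , λ ¬petal v v∈S v∈M → independent⇒petal mp v∈S v∈M ¬petal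

    -- Deleting `v` leaves no stamen vertex in Type 1, a single one joined to the whole boundary in
    -- Type 2, and part of a clique in Type 3.
    stamen-clique : ∀ {M X v} → Petal G H M → Stamen G H M X → v ∈ X →
                    ∀ x y → (x ∈ X × x ≢ v) ⊎ InBoundary G H M x →
                    (y ∈ X × y ≢ v) ⊎ InBoundary G H M y → x ≢ y → Adj G x y
    stamen-clique (_ , _ , ∂-clique) _ _ x y (inj₂ ∂x) (inj₂ ∂y) x≢y = ∂-clique x y ∂x ∂y x≢y
    stamen-clique {X = X} _ (_ , inj₁ single) v∈X x _ (inj₁ (x∈X , x≢v)) _ _ =
      contradiction (∣p∣≥2 X x∈X v∈X x≢v) (<-irrefl (≡.sym single))
    stamen-clique {X = X} _ (_ , inj₁ single) v∈X _ y (inj₂ _) (inj₁ (y∈X , y≢v)) _ =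
      contradiction (∣p∣≥2 X y∈X v∈X y≢v) (<-irrefl (≡.sym single))
    stamen-clique {v = v} _ (_ , inj₂ (inj₁ (u₁ , u₂ , _ , only , _ , _ , _))) v∈X
      x y (inj₁ (x∈X , x≢v)) (inj₁ (y∈X , y≢v)) x≢y
      with only x x∈X | only y y∈X | only v v∈X
    ... | inj₁ refl | inj₁ refl | _         = contradiction refl x≢y
    ... | inj₂ refl | inj₂ refl | _         = contradiction refl x≢y
    ... | inj₁ refl | inj₂ refl | inj₁ refl = contradiction refl x≢v
    ... | inj₁ refl | inj₂ refl | inj₂ refl = contradiction refl y≢v
    ... | inj₂ refl | inj₁ refl | inj₁ refl = contradiction refl y≢v
    ... | inj₂ refl | inj₁ refl | inj₂ refl = contradiction refl x≢v
    stamen-clique _ (_ , inj₂ (inj₁ (_ , _ , _ , only , _ , _ , ∂~))) _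
      x y (inj₁ (x∈X , _)) (inj₂ ∂y) _ with only x x∈X
    ... | inj₁ refl = sym G (proj₁ (∂~ y ∂y))
    ... | inj₂ refl = sym G (proj₂ (∂~ y ∂y))
    stamen-clique _ (_ , inj₂ (inj₁ (_ , _ , _ , only , _ , _ , ∂~))) _
      x y (inj₂ ∂x) (inj₁ (y∈X , _)) _ with only y y∈X
    ... | inj₁ refl = proj₁ (∂~ x ∂x)
    ... | inj₂ refl = proj₂ (∂~ x ∂x)
    stamen-clique _ (_ , inj₂ (inj₂ (_ , clique))) _ x y x∈ y∈ =
      clique x y (forget x∈) (forget y∈)
      where
      forget : ∀ {A B C : Set} → (A × B) ⊎ C → A ⊎ C
      forget = [ inj₁ ∘ proj₁ , inj₂ ]′

    stamenCondition⇒independent : StamenCondition G S H → MIndependent G S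
    stamenCondition⇒independent condition v v∈S inHull with vertex⇒∈mp (S⊆H v∈S)
    ... | M , mp , v∈M =
      -- `avoidable` shows that `M` is no petal, and then the second half of the condition forbids
      -- `v ∈ M`.
      proj₂ (condition M mp) (λ petal → avoidable petal (proj₁ (condition M mp) petal)) v v∈S v∈M
      where
      avoidable : Petal G H M → ¬ (∃[ X ] (Stamen G H M X × (∀ u → u ∈ S → u ∈ M → u ∈ X)))
      avoidable petal (X , stamen@(X⊆M° , _) , S∩M⊆X) =
        proj₂ (proj₂ (∈⟪⟫⁻ Y? (inHull ⟪ Y? ⟫ S-v⊆Y Y-convex)) (X⊆M° v v∈X)) refl
        where
        v∈X : v ∈ X
        v∈X = S∩M⊆X v v∈S v∈M
        -- Since `X` consists of interior vertices, this set is `H` without the interior of `M`,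
        -- together with `X - v`.
        Y? : ∀ u → Dec (u ∈ H × (InInterior G H M u → u ∈ X × u ≢ v))
        Y? u = u ∈? H ×-dec interior? H M u →-dec u ∈? X ×-dec ¬? (u ≟ v)
        S-v⊆Y : S - v ⊆ ⟪ Y? ⟫
        S-v⊆Y u∈ = let u∈S = p─q⊆p S ⁅ v ⁆ u∈ in ∈⟪⟫⁺ Y?
          (S⊆H u∈S , λ u∈M° → S∩M⊆X _ u∈S (proj₁ u∈M°) , x∈p-y⇒x≢y S v u∈)
        kind : ∀ {u} → u ∈ ⟪ Y? ⟫ → u ∈ M → (u ∈ X × u ≢ v) ⊎ InBoundary G H M u
        kind {u} u∈Y u∈M with interior? H M u
        ... | yes u∈M° = inj₁ (proj₂ (∈⟪⟫⁻ Y? u∈Y) u∈M°)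
        ... | no u∉M°  = inj₂ (¬interior⇒boundary u∈M u∉M°)
        Y-convex : MConvex G ⟪ Y? ⟫
        Y-convex = shrink-in-mp⇒convex (flower-convex flower) mp (proj₁ ∘ ∈⟪⟫⁻ Y?)
          (λ {u} u∈H u∉Y → decidable-stable (interior? H M u) λ u∉M° →
            u∉Y (∈⟪⟫⁺ Y? (u∈H , λ u∈M° → contradiction u∈M° u∉M°)))
          λ {a} {b} a∈Y a∈M b∈Y b∈M →
            stamen-clique petal stamen v∈X a b (kind a∈Y a∈M) (kind b∈Y b∈M)

theorem2 : ∀ {n : ℕ} (G : Graph n) (S H : Subset n) →
    Connected G ⊤ →
    MinFlowerContainingHull G S H →
    (MIndependent G S ⇔ StamenCondition G S H)
theorem2 G S H _ min =
  mk⇔ (independent⇒stamenCondition G min) (stamenCondition⇒independent G min)
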